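{- Let $\gamma \geq 0$ be an integer and $b \in [\gamma]$. The element $$\bullet_b := \pi\Big(\sum_{a \in [b]} \leftharpoonup_a + \rightharpoonup_a\Big)$$ of $\mathsf{Dendr}_\gamma$, where $\pi : \mathbf{Free}(\{\leftharpoonup_a, \rightharpoonup_a : a \in [\gamma]\}) \to \mathsf{Dendr}_\gamma$ is the canonical surjection map, is associative.
   Context: The ground field has characteristic zero; operad means nonsymmetric operad; $[n] = \{1, \dots, n\}$; $a \uparrow a' := \max(a, a')$. An element $x$ of arity $2$ of an operad is associative if $x \circ_1 x = x \circ_2 x$. $\mathbf{Free}(\mathfrak{G})$ is the free operad on a set $\mathfrak{G}$ of binary generators. Koszul dual: if $\mathcal{O}$ has a presentation $(\mathfrak{G}, \mathfrak{R})$ (that is, $\mathcal{O} \cong \mathbf{Free}(\mathfrak{G})/\langle \mathfrak{R} \rangle$) with $\mathfrak{G}$ in arity $2$ and $\mathfrak{R} \subseteq \mathbf{Free}(\mathfrak{G})(3)$, its Koszul dual is $\mathbf{Free}(\mathfrak{G})/\langle \mathfrak{R}^\perp \rangle$, where $\mathfrak{R}^\perp$ is the annihilator of $\mathfrak{R}$ in $\mathbf{Free}(\mathfrak{G})(3)$ for the bilinear form with $\langle x \circ_i y, x' \circ_{i'} y' \rangle = 1$ if $x = x', y = y', i = i' = 1$; $= -1$ if $x = x', y = y', i = i' = 2$; and $0$ otherwise ($x, x', y, y' \in \mathfrak{G}$). $\mathsf{Dias}_\gamma$ is the operad presented by binary generators $\dashv_a, \vdash_a$, $a \in [\gamma]$,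 and the space of relations spanned, for all $a, a' \in [\gamma]$, by $\dashv_a \circ_1 \vdash_{a'} - \vdash_{a'} \circ_2 \dashv_a$; $\dashv_a \circ_1 \dashv_{a \uparrow a'} - \dashv_a \circ_2 \vdash_{a'}$; $\vdash_a \circ_1 \dashv_{a'} - \vdash_a \circ_2 \vdash_{a \uparrow a'}$; $\dashv_{a \uparrow a'} \circ_1 \dashv_a - \dashv_a \circ_2 \dashv_{a'}$; $\vdash_a \circ_1 \vdash_{a'} - \vdash_{a \uparrow a'} \circ_2 \vdash_a$. $\mathsf{Dendr}_\gamma$ is the Koszul dual of $\mathsf{Dias}_\gamma$ computed from this presentation, where in the dual the generators corresponding to $\dashv_a$ and $\vdash_a$ are denoted by $\leftharpoonup_a$ and $\rightharpoonup_a$ respectively. -}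

module Defs where

open import Algebra.Apartness.Bundles using (HeytingField; HeytingCommutativeRing)
open import Algebra.Bundles using (CommutativeMonoid; CommutativeRing)
open import Algebra.Module.Bundles using (LeftModule)
open import Algebra.Module.Construct.TensorUnit using (leftModule)
open import Data.Bool.Base using (if_then_else_; _∧_)
open import Data.Fin.Base as Fin using (Fin; zero; suc; toℕ)
open import Data.Fin.Properties as Fin using (toℕ<n)
open import Data.Product.Base using (_,_)
open import Data.List.Base using (foldr; map; filter; allFin)
open import Data.Nat.Base using (ℕ; zero; suc; _+_; _∸_; _≤_; _<_; s≤s)
open import Data.Nat.Properties as ℕ using (_<?_)
open import Function.Base using (_$_)
open import Level using (Level; _⊔_) renaming (suc to lsuc)
open import Relation.Binary.Definitions using (DecidableEquality)
open import Relation.Binary.PropositionalEquality as ≡ using (_≡_; refl; cong; cong₂; module ≡-Reasoning)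
open import Relation.Nullary using (¬_; yes; no; does; recompute)
open import Relation.Nullary.Decidable using (map′)
open import Relation.Unary using (Pred; _∈_)
import Algebra.Construct.NaturalChoice.Max as Max
import Algebra.Definitions.RawMonoid as RawMonoidDefinitions
import Algebra.Properties.AbelianGroup as AbelianGroupProperties
import Algebra.Properties.CommutativeSemigroup as CommutativeSemigroupProperties
import Relation.Binary.Reasoning.Setoid as SetoidReasoning

heytingField⇒commutativeRing : ∀ {c ℓ₁ ℓ₂} → HeytingField c ℓ₁ ℓ₂ → CommutativeRing c ℓ₁
heytingField⇒commutativeRing K =
  HeytingCommutativeRing.commutativeRing (HeytingField.heytingCommutativeRing K)

CharacteristicZero : ∀ {c ℓ₁ ℓ₂} → HeytingField c ℓ₁ ℓ₂ → Set ℓ₁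
CharacteristicZero K = ∀ n → ¬ (suc n × 1# ≈ 0#)
  where
  open CommutativeRing (heytingField⇒commutativeRing K)
  open RawMonoidDefinitions +-rawMonoid using (_×_)

module _ (Gen : Set) where

  data BinTree : Set where
    leaf : BinTree
    node : Gen → BinTree → BinTree → BinTree

module _ {Gen : Set} where

  leaves : BinTree Gen → ℕ
  leaves leaf         = 1
  leaves (node _ l r) = leaves l + leaves r

  -- Replace the i-th leaf of the first tree (leaves are numbered from 0,
  -- left to right) by the second tree. Only used for i < leaves t.
  graft : BinTree Gen → ℕ → BinTree Gen → BinTree Gen
  graft leaf         i u = u
  graft (node x l r) i u with i <? leaves l
  ... | yes _ = node x (graft l i u) r
  ... | no  _ = node x l (graft r (i ∸ leaves l) u)

  leaves-graft : ∀ t i u → suc (leaves (graft t i u)) ≡ leaves t + leaves u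
  leaves-graft leaf         i u = refl
  leaves-graft (node x l r) i u with i <? leaves l
  ... | yes _ = begin
    suc (leaves (graft l i u)) + leaves r  ≡⟨ cong (_+ leaves r) (leaves-graft l i u) ⟩
    leaves l + leaves u + leaves r         ≡⟨ ℕ.+-assoc (leaves l) _ _ ⟩
    leaves l + (leaves u + leaves r)       ≡⟨ cong (leaves l +_) (ℕ.+-comm (leaves u) _) ⟩
    leaves l + (leaves r + leaves u)       ≡⟨ ℕ.+-assoc (leaves l) _ _ ⟨
    leaves l + leaves r + leaves u         ∎
    where open ≡-Reasoning
  ... | no  _ = begin
    suc (leaves l + leaves (graft r _ u))  ≡⟨ ℕ.+-suc (leaves l) _ ⟨
    leaves l + suc (leaves (graft r _ u))  ≡⟨ cong (leaves l +_) (leaves-graft r _ u) ⟩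
    leaves l + (leaves r + leaves u)       ≡⟨ ℕ.+-assoc (leaves l) _ _ ⟨
    leaves l + leaves r + leaves u         ∎
    where open ≡-Reasoning

  graft-left : ∀ x l r {i} u → i < leaves l → graft (node x l r) i u ≡ node x (graft l i u) r
  graft-left x l r {i} u i<l with i <? leaves l
  ... | yes _   = refl
  ... | no  i≮l with () ← i≮l i<l

  graft-right : ∀ x l r {i} u → leaves l ≤ i →
                graft (node x l r) i u ≡ node x l (graft r (i ∸ leaves l) u)
  graft-right x l r {i} u l≤i with i <? leaves l
  ... | yes i<l with () ← ℕ.≤⇒≯ l≤i i<l
  ... | no  _   = refl

  graft-identityʳ : ∀ t i → graft t i leaf ≡ t
  graft-identityʳ leaf         i = refl
  graft-identityʳ (node x l r) i with i <? leaves l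
  ... | yes _ = cong (λ l′ → node x l′ r) (graft-identityʳ l i)
  ... | no  _ = cong (node x l) (graft-identityʳ r _)

  private
    ∸-< : ∀ {i a b} → a ≤ i → i < a + b → i ∸ a < b
    ∸-< {i} {a} {b} a≤i i<a+b = ℕ.+-cancelˡ-< a _ _ $
      ≡.subst (_< a + b) (≡.sym (ℕ.m+[n∸m]≡n a≤i)) i<a+b

  graft-sequential : ∀ t u v {i j} → i < leaves t → j < leaves u →
                     graft (graft t i u) (i + j) v ≡ graft t i (graft u j v)
  graft-sequential leaf u v {zero}  _ _ = refl
  graft-sequential leaf u v {suc _} (s≤s ()) _
  graft-sequential (node x l r) u v {i} {j} i<t j<u with i <? leaves l
  ... | yes i<l = ≡.trans
    (graft-left x _ r v (ℕ.≤-pred (begin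
      suc (suc (i + j))           ≡⟨ cong suc (ℕ.+-suc i j) ⟨
      suc i + suc j               ≤⟨ ℕ.+-mono-≤ i<l j<u ⟩
      leaves l + leaves u         ≡⟨ leaves-graft l i u ⟨
      suc (leaves (graft l i u))  ∎)))
    (cong (λ l′ → node x l′ r) (graft-sequential l u v i<l j<u))
    where open ℕ.≤-Reasoning
  ... | no  i≮l = ≡.trans
    (graft-right x l _ v (ℕ.≤-trans l≤i (ℕ.m≤m+n i j)))
    (cong (node x l) (≡.trans
      (cong (λ k → graft (graft r (i ∸ leaves l) u) k v) (ℕ.+-∸-comm j l≤i))
      (graft-sequential r u v (∸-< l≤i i<t) j<u)))
    where l≤i = ℕ.≮⇒≥ i≮l

  graft-parallel : ∀ t u v {i k k′} → i < k → k < leaves t → suc k′ ≡ k + leaves u →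
                   graft (graft t i u) k′ v ≡ graft (graft t k v) i u
  graft-parallel leaf u v {k = suc _} _ (s≤s ()) _
  graft-parallel (node x l r) u v {i} {k} {k′} i<k k<t eq with k <? leaves l
  ... | yes k<l = begin
    graft (graft (node x l r) i u) k′ v     ≡⟨ cong (λ t → graft t k′ v) (graft-left x l r u i<l) ⟩
    graft (node x (graft l i u) r) k′ v     ≡⟨ graft-left x _ r v k′<l ⟩
    node x (graft (graft l i u) k′ v) r     ≡⟨ cong (λ l′ → node x l′ r) (graft-parallel l u v i<k k<l eq) ⟩
    node x (graft (graft l k v) i u) r      ≡⟨ graft-left x _ r u i<l′ ⟨
    graft (node x (graft l k v) r) i u      ∎
    where
    open ≡-Reasoning
    i<l = ℕ.<-trans i<k k<l
    k′<l : k′ < leaves (graft l i u)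
    k′<l = ℕ.≤-pred (≡.subst₂ _<_ (≡.sym eq) (≡.sym (leaves-graft l i u)) (ℕ.+-monoˡ-< (leaves u) k<l))
    i<l′ : i < leaves (graft l k v)
    i<l′ = ℕ.≤-trans i<k (ℕ.≤-pred (ℕ.≤-trans k<l (ℕ.≤-trans (ℕ.m≤m+n (leaves l) (leaves v))
             (ℕ.≤-reflexive (≡.sym (leaves-graft l k v))))))
  ... | no  k≮l with i <? leaves l
  ... | yes i<l = begin
    graft (node x (graft l i u) r) k′ v                      ≡⟨ graft-right x _ r v l′≤k′ ⟩
    node x (graft l i u) (graft r (k′ ∸ leaves (graft l i u)) v)
      ≡⟨ cong (λ j → node x (graft l i u) (graft r j v)) k′∸l′≡k∸l ⟩
    node x (graft l i u) (graft r (k ∸ leaves l) v)          ∎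
    where
    open ≡-Reasoning
    l≤k = ℕ.≮⇒≥ k≮l
    l′≤k′ : leaves (graft l i u) ≤ k′
    l′≤k′ = ℕ.≤-pred (≡.subst₂ _≤_ (≡.sym (leaves-graft l i u)) (≡.sym eq) (ℕ.+-monoˡ-≤ (leaves u) l≤k))
    k′∸l′≡k∸l : k′ ∸ leaves (graft l i u) ≡ k ∸ leaves l
    k′∸l′≡k∸l = begin
      suc k′ ∸ suc (leaves (graft l i u))           ≡⟨ cong₂ _∸_ eq (leaves-graft l i u) ⟩
      (k + leaves u) ∸ (leaves l + leaves u)        ≡⟨ cong₂ _∸_ (ℕ.+-comm k _) (ℕ.+-comm (leaves l) _) ⟩
      (leaves u + k) ∸ (leaves u + leaves l)        ≡⟨ ℕ.[m+n]∸[m+o]≡n∸o (leaves u) k (leaves l) ⟩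
      k ∸ leaves l                                  ∎
  ... | no  i≮l = begin
    graft (node x l (graft r (i ∸ leaves l) u)) k′ v         ≡⟨ graft-right x l _ v l≤k′ ⟩
    node x l (graft (graft r (i ∸ leaves l) u) (k′ ∸ leaves l) v)
      ≡⟨ cong (node x l) (graft-parallel r u v (ℕ.∸-monoˡ-< i<k l≤i) (∸-< l≤k k<t) eq′) ⟩
    node x l (graft (graft r (k ∸ leaves l) v) (i ∸ leaves l) u) ∎
    where
    open ≡-Reasoning
    l≤k = ℕ.≮⇒≥ k≮l
    l≤i = ℕ.≮⇒≥ i≮l
    l≤k′ : leaves l ≤ k′
    l≤k′ = ℕ.≤-pred (≡.subst (leaves l <_) (≡.sym eq)
             (ℕ.≤-trans (s≤s l≤i) (ℕ.≤-trans i<k (ℕ.m≤m+n k (leaves u)))))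
    eq′ : suc (k′ ∸ leaves l) ≡ k ∸ leaves l + leaves u
    eq′ = begin
      suc (k′ ∸ leaves l)       ≡⟨ ℕ.+-∸-assoc 1 l≤k′ ⟨
      suc k′ ∸ leaves l         ≡⟨ cong (_∸ leaves l) eq ⟩
      k + leaves u ∸ leaves l   ≡⟨ ℕ.+-∸-comm (leaves u) l≤k ⟩
      k ∸ leaves l + leaves u   ∎

record Tree (Gen : Set) (n : ℕ) : Set where
  constructor mkTree
  field
    shape  : BinTree Gen
    .arity : leaves shape ≡ n

module _ {Gen : Set} where

  identityTree : Tree Gen 1
  identityTree = mkTree leaf refl

  corolla : Gen → Tree Gen 2
  corolla x = mkTree (node x leaf leaf) refl

  graftTree : ∀ {n m p} → n + m ≡ suc p → Fin n → Tree Gen n → Tree Gen m → Tree Gen p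
  graftTree e i (mkTree t a) (mkTree u b) = mkTree (graft t (toℕ i) u)
    (ℕ.suc-injective (≡.trans (leaves-graft t (toℕ i) u) (≡.trans (cong₂ _+_ a b) e)))

  shape-injective : ∀ {n} {t u : Tree Gen n} → Tree.shape t ≡ Tree.shape u → t ≡ u
  shape-injective refl = refl

  private
    toℕ<leaves : ∀ {n} (t : BinTree Gen) → .(leaves t ≡ n) → (i : Fin n) → toℕ i < leaves t
    toℕ<leaves {n} t a i = ≡.subst (toℕ i <_) (≡.sym (recompute (leaves t ℕ.≟ n) a)) (toℕ<n i)

  graftTree-sequential : ∀ {n m l p q r} (e₁ : n + m ≡ suc p) (e₂ : p + l ≡ suc r)
    (e₃ : m + l ≡ suc q) (e₄ : n + q ≡ suc r) (i : Fin n) (j : Fin m) (k : Fin p) →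
    toℕ k ≡ toℕ i + toℕ j → ∀ t u v →
    graftTree e₂ k (graftTree e₁ i t u) v ≡ graftTree e₄ i t (graftTree e₃ j u v)
  graftTree-sequential _ _ _ _ i j k k≡i+j (mkTree t a) (mkTree u b) (mkTree v c) = shape-injective $ ≡.trans
    (cong (λ h → graft (graft t (toℕ i) u) h v) k≡i+j)
    (graft-sequential t u v (toℕ<leaves t a i) (toℕ<leaves u b j))

  graftTree-parallel : ∀ {n m l p q r} (e₁ : n + m ≡ suc p) (e₂ : p + l ≡ suc r)
    (e₃ : n + l ≡ suc q) (e₄ : q + m ≡ suc r) (i k : Fin n) (k′ : Fin p) (i′ : Fin q) →
    toℕ i < toℕ k → suc (toℕ k′) ≡ toℕ k + m → toℕ i′ ≡ toℕ i → ∀ t u v →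
    graftTree e₂ k′ (graftTree e₁ i t u) v ≡ graftTree e₄ i′ (graftTree e₃ k t v) u
  graftTree-parallel {m = m} _ _ _ _ i k k′ i′ i<k k′≡ i′≡i (mkTree t a) (mkTree u b) (mkTree v c) =
    shape-injective $ ≡.trans
      (graft-parallel t u v i<k (toℕ<leaves t a k)
        (≡.trans k′≡ (cong (toℕ k +_) (≡.sym (recompute (leaves u ℕ.≟ m) b)))))
      (cong (λ h → graft (graft t (toℕ k) v) h u) (≡.sym i′≡i))

module OverField {c ℓ₁ ℓ₂ : Level} (K : HeytingField c ℓ₁ ℓ₂) where

  private
    module K = CommutativeRing (heytingField⇒commutativeRing K)

  open K using (0#; 1#)

  VectorSpace : (m ℓ : Level) → Set (c ⊔ ℓ₁ ⊔ lsuc (m ⊔ ℓ))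
  VectorSpace m ℓ = LeftModule K.ring m ℓ

  module _ {m ℓ r : Level} (V : VectorSpace m ℓ) (S : Pred (LeftModule.Carrierᴹ V) r) where
    open LeftModule V

    data Span : Pred Carrierᴹ (c ⊔ m ⊔ ℓ ⊔ r) where
      incl  : ∀ {x} → x ∈ S → x ∈ Span
      resp  : ∀ {x y} → x ≈ᴹ y → x ∈ Span → y ∈ Span
      zero  : 0ᴹ ∈ Span
      add   : ∀ {x y} → x ∈ Span → y ∈ Span → (x +ᴹ y) ∈ Span
      scale : ∀ {x} k → x ∈ Span → (k *ₗ x) ∈ Span

  -- The vector space with basis X: linear expressions in elements of X,
  -- identified modulo the vector space axioms.

  data Lin (X : Set) : Set c where
    var : X → Lin X
    𝟘   : Lin X
    _⊕_ : Lin X → Lin X → Lin X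
    _·_ : K.Carrier → Lin X → Lin X

  infixl 6 _⊕_
  infixr 7 _·_
  infix  4 _≋_

  data _≋_ {X : Set} : Lin X → Lin X → Set (c ⊔ ℓ₁) where
    ≋-refl      : ∀ {x} → x ≋ x
    ≋-sym       : ∀ {x y} → x ≋ y → y ≋ x
    ≋-trans     : ∀ {x y z} → x ≋ y → y ≋ z → x ≋ z
    ⊕-cong      : ∀ {x x′ y y′} → x ≋ x′ → y ≋ y′ → x ⊕ y ≋ x′ ⊕ y′
    ·-cong      : ∀ {a b x y} → a K.≈ b → x ≋ y → a · x ≋ b · y
    ⊕-assoc     : ∀ x y z → (x ⊕ y) ⊕ z ≋ x ⊕ (y ⊕ z)
    ⊕-comm      : ∀ x y → x ⊕ y ≋ y ⊕ x
    ⊕-identityˡ : ∀ x → 𝟘 ⊕ x ≋ x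
    ·-distribˡ  : ∀ a x y → a · (x ⊕ y) ≋ a · x ⊕ a · y
    ·-distribʳ  : ∀ x a b → (a K.+ b) · x ≋ a · x ⊕ b · x
    ·-assoc     : ∀ a b x → (a K.* b) · x ≋ a · b · x
    ·-identityˡ : ∀ x → 1# · x ≋ x
    ·-zeroˡ     : ∀ x → 0# · x ≋ 𝟘

  freeVectorSpace : Set → VectorSpace c (c ⊔ ℓ₁)
  freeVectorSpace X = record
    { Carrierᴹ = Lin X
    ; _≈ᴹ_     = _≋_
    ; _+ᴹ_     = _⊕_
    ; _*ₗ_     = _·_
    ; 0ᴹ       = 𝟘
    ; -ᴹ_      = K.- 1# ·_
    ; isLeftModule = record
      { isLeftSemimodule = record
        { +ᴹ-isCommutativeMonoid = record
          { isMonoid = record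
            { isSemigroup = record
              { isMagma = record
                { isEquivalence = record { refl = ≋-refl ; sym = ≋-sym ; trans = ≋-trans }
                ; ∙-cong        = ⊕-cong
                }
              ; assoc = ⊕-assoc
              }
            ; identity = ⊕-identityˡ , λ x → ≋-trans (⊕-comm x 𝟘) (⊕-identityˡ x)
            }
          ; comm = ⊕-comm
          }
        ; isPreleftSemimodule = record
          { *ₗ-cong      = ·-cong
          ; *ₗ-zeroˡ     = ·-zeroˡ
          ; *ₗ-distribʳ  = ·-distribʳ
          ; *ₗ-identityˡ = ·-identityˡ
          ; *ₗ-assoc     = ·-assoc
          ; *ₗ-zeroʳ     = zeroʳ
          ; *ₗ-distribˡ  = ·-distribˡ
          }
        }
      ; -ᴹ‿cong    = ·-cong K.refl
      ; -ᴹ‿inverse = inverseˡ , λ x → ≋-trans (⊕-comm x _) (inverseˡ x)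
      }
    }
    where
    zeroʳ : ∀ a → a · 𝟘 ≋ 𝟘
    zeroʳ a = ≋-trans (·-cong K.refl (≋-sym (·-zeroˡ 𝟘)))
      (≋-trans (≋-sym (·-assoc a 0# 𝟘)) (≋-trans (·-cong (K.zeroʳ a) ≋-refl) (·-zeroˡ 𝟘)))
    inverseˡ : ∀ x → (K.- 1#) · x ⊕ x ≋ 𝟘
    inverseˡ x = ≋-trans (⊕-cong ≋-refl (≋-sym (·-identityˡ x)))
      (≋-trans (≋-sym (·-distribʳ x (K.- 1#) 1#))
        (≋-trans (·-cong (K.-‿inverseˡ 1#) ≋-refl) (·-zeroˡ x)))

  module _ {m ℓ : Level} (V : VectorSpace m ℓ) where
    open LeftModule V
    open CommutativeSemigroupProperties
      (CommutativeMonoid.commutativeSemigroup +ᴹ-commutativeMonoid) using (interchange)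

    extend : ∀ {X} → (X → Carrierᴹ) → Lin X → Carrierᴹ
    extend f (var x) = f x
    extend f 𝟘       = 0ᴹ
    extend f (x ⊕ y) = extend f x +ᴹ extend f y
    extend f (a · x) = a *ₗ extend f x

    extend₂ : ∀ {X Y} → (X → Y → Carrierᴹ) → Lin X → Lin Y → Carrierᴹ
    extend₂ f x y = extend (λ s → extend (f s) y) x

    extend-cong : ∀ {X} (f : X → Carrierᴹ) {x y} → x ≋ y → extend f x ≈ᴹ extend f y
    extend-cong f ≋-refl              = ≈ᴹ-refl
    extend-cong f (≋-sym p)           = ≈ᴹ-sym (extend-cong f p)
    extend-cong f (≋-trans p q)       = ≈ᴹ-trans (extend-cong f p) (extend-cong f q)
    extend-cong f (⊕-cong p q)        = +ᴹ-cong (extend-cong f p) (extend-cong f q)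
    extend-cong f (·-cong a p)        = *ₗ-cong a (extend-cong f p)
    extend-cong f (⊕-assoc x y z)     = +ᴹ-assoc _ _ _
    extend-cong f (⊕-comm x y)        = +ᴹ-comm _ _
    extend-cong f (⊕-identityˡ x)     = +ᴹ-identityˡ _
    extend-cong f (·-distribˡ a x y)  = *ₗ-distribˡ a _ _
    extend-cong f (·-distribʳ x a b)  = *ₗ-distribʳ _ a b
    extend-cong f (·-assoc a b x)     = *ₗ-assoc a b _
    extend-cong f (·-identityˡ x)     = *ₗ-identityˡ _
    extend-cong f (·-zeroˡ x)         = *ₗ-zeroˡ _

    extend-congᶠ : ∀ {X} {f g : X → Carrierᴹ} → (∀ s → f s ≈ᴹ g s) →
                   ∀ x → extend f x ≈ᴹ extend g x
    extend-congᶠ f≈g (var s) = f≈g s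
    extend-congᶠ f≈g 𝟘       = ≈ᴹ-refl
    extend-congᶠ f≈g (x ⊕ y) = +ᴹ-cong (extend-congᶠ f≈g x) (extend-congᶠ f≈g y)
    extend-congᶠ f≈g (a · x) = *ₗ-congˡ (extend-congᶠ f≈g x)

    extend₂-cong : ∀ {X Y} (f : X → Y → Carrierᴹ) {x x′ y y′} → x ≋ x′ → y ≋ y′ →
                   extend₂ f x y ≈ᴹ extend₂ f x′ y′
    extend₂-cong f {x′ = x′} p q =
      ≈ᴹ-trans (extend-cong _ p) (extend-congᶠ (λ s → extend-cong (f s) q) x′)

    extend₂-zeroʳ : ∀ {X Y} (f : X → Y → Carrierᴹ) x → extend₂ f x 𝟘 ≈ᴹ 0ᴹ
    extend₂-zeroʳ f (var s) = ≈ᴹ-refl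
    extend₂-zeroʳ f 𝟘       = ≈ᴹ-refl
    extend₂-zeroʳ f (x ⊕ y) =
      ≈ᴹ-trans (+ᴹ-cong (extend₂-zeroʳ f x) (extend₂-zeroʳ f y)) (+ᴹ-identityˡ 0ᴹ)
    extend₂-zeroʳ f (a · x) = ≈ᴹ-trans (*ₗ-congˡ (extend₂-zeroʳ f x)) (*ₗ-zeroʳ a)

    extend₂-addʳ : ∀ {X Y} (f : X → Y → Carrierᴹ) x y z →
                   extend₂ f x (y ⊕ z) ≈ᴹ extend₂ f x y +ᴹ extend₂ f x z
    extend₂-addʳ f (var s) y z = ≈ᴹ-refl
    extend₂-addʳ f 𝟘       y z = ≈ᴹ-sym (+ᴹ-identityˡ 0ᴹ)
    extend₂-addʳ f (w ⊕ x) y z =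
      ≈ᴹ-trans (+ᴹ-cong (extend₂-addʳ f w y z) (extend₂-addʳ f x y z)) (interchange _ _ _ _)
    extend₂-addʳ f (a · x) y z = ≈ᴹ-trans (*ₗ-congˡ (extend₂-addʳ f x y z)) (*ₗ-distribˡ a _ _)

    extend₂-scaleʳ : ∀ {X Y} (f : X → Y → Carrierᴹ) x a y →
                     extend₂ f x (a · y) ≈ᴹ a *ₗ extend₂ f x y
    extend₂-scaleʳ f (var s) a y = ≈ᴹ-refl
    extend₂-scaleʳ f 𝟘       a y = ≈ᴹ-sym (*ₗ-zeroʳ a)
    extend₂-scaleʳ f (w ⊕ x) a y = ≈ᴹ-trans
      (+ᴹ-cong (extend₂-scaleʳ f w a y) (extend₂-scaleʳ f x a y)) (≈ᴹ-sym (*ₗ-distribˡ a _ _))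
    extend₂-scaleʳ f (b · x) a y = ≈ᴹ-trans (*ₗ-congˡ (extend₂-scaleʳ f x a y))
      (≈ᴹ-trans (≈ᴹ-sym (*ₗ-assoc b a _)) (≈ᴹ-trans (*ₗ-congʳ (K.*-comm b a)) (*ₗ-assoc a b _)))

  -- Inputs are numbered from 0. Instead of landing in arity n + m ∸ 1, the
  -- partial composition takes the output arity p together with a proof that
  -- n + m ≡ suc p; the axioms then need no transport along equalities of
  -- arities, and quantify over all legitimate positions k, i′ and k′.

  record Operad (m ℓ : Level) : Set (c ⊔ ℓ₁ ⊔ lsuc (m ⊔ ℓ)) where
    field
      component : ℕ → VectorSpace m ℓ

    open module Component {n} = LeftModule (component n) public
      hiding (Carrierᴹ)

    Element : ℕ → Set m
    Element n = LeftModule.Carrierᴹ (component n)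

    field
      𝟏    : Element 1
      comp : ∀ {n m p} → n + m ≡ suc p → Fin n → Element n → Element m → Element p

      comp-cong   : ∀ {n m p} (e : n + m ≡ suc p) (i : Fin n)
                    {x x′ : Element n} {y y′ : Element m} → x ≈ᴹ x′ → y ≈ᴹ y′ →
                    comp e i x y ≈ᴹ comp e i x′ y′
      comp-addˡ   : ∀ {n m p} (e : n + m ≡ suc p) (i : Fin n) (x x′ : Element n) (y : Element m) →
                    comp e i (x +ᴹ x′) y ≈ᴹ comp e i x y +ᴹ comp e i x′ y
      comp-scaleˡ : ∀ {n m p} (e : n + m ≡ suc p) (i : Fin n) a (x : Element n) (y : Element m) →
                    comp e i (a *ₗ x) y ≈ᴹ a *ₗ comp e i x y
      comp-addʳ   : ∀ {n m p} (e : n + m ≡ suc p) (i : Fin n) (x : Element n) (y y′ : Element m) →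
                    comp e i x (y +ᴹ y′) ≈ᴹ comp e i x y +ᴹ comp e i x y′
      comp-scaleʳ : ∀ {n m p} (e : n + m ≡ suc p) (i : Fin n) (x : Element n) a (y : Element m) →
                    comp e i x (a *ₗ y) ≈ᴹ a *ₗ comp e i x y

      identityˡ   : ∀ {m} (e : 1 + m ≡ suc m) (y : Element m) → comp e zero 𝟏 y ≈ᴹ y
      identityʳ   : ∀ {n} (e : n + 1 ≡ suc n) (i : Fin n) (x : Element n) → comp e i x 𝟏 ≈ᴹ x
      sequential  : ∀ {n m l p q r} (e₁ : n + m ≡ suc p) (e₂ : p + l ≡ suc r)
                    (e₃ : m + l ≡ suc q) (e₄ : n + q ≡ suc r)
                    (i : Fin n) (j : Fin m) (k : Fin p) → toℕ k ≡ toℕ i + toℕ j →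
                    (x : Element n) (y : Element m) (z : Element l) →
                    comp e₂ k (comp e₁ i x y) z ≈ᴹ comp e₄ i x (comp e₃ j y z)
      parallel    : ∀ {n m l p q r} (e₁ : n + m ≡ suc p) (e₂ : p + l ≡ suc r)
                    (e₃ : n + l ≡ suc q) (e₄ : q + m ≡ suc r)
                    (i k : Fin n) (k′ : Fin p) (i′ : Fin q) →
                    toℕ i < toℕ k → suc (toℕ k′) ≡ toℕ k + m → toℕ i′ ≡ toℕ i →
                    (x : Element n) (y : Element m) (z : Element l) →
                    comp e₂ k′ (comp e₁ i x y) z ≈ᴹ comp e₄ i′ (comp e₃ k x z) y

    infixl 8 _∘₁_ _∘₂_

    _∘₁_ _∘₂_ : Element 2 → Element 2 → Element 3
    x ∘₁ y = comp refl zero x y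
    x ∘₂ y = comp refl (suc zero) x y

  IsAssociative : ∀ {m ℓ} (P : Operad m ℓ) → Operad.Element P 2 → Set ℓ
  IsAssociative P x = x ∘₁ x ≈ᴹ x ∘₂ x
    where open Operad P

  module _ {m ℓ r : Level} (P : Operad m ℓ) {d : ℕ} (R : Pred (Operad.Element P d) r) where
    open Operad P

    data Ideal : ∀ {n} → Pred (Element n) (c ⊔ m ⊔ ℓ ⊔ r) where
      incl  : ∀ {x} → x ∈ R → Ideal x
      resp  : ∀ {n} {x y : Element n} → x ≈ᴹ y → Ideal x → Ideal y
      zero  : ∀ {n} → Ideal (0ᴹ {n})
      add   : ∀ {n} {x y : Element n} → Ideal x → Ideal y → Ideal (x +ᴹ y)
      scale : ∀ {n} {x : Element n} k → Ideal x → Ideal (k *ₗ x)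
      compˡ : ∀ {n m p} (e : n + m ≡ suc p) (i : Fin n) {x : Element n} (y : Element m) →
              Ideal x → Ideal (comp e i x y)
      compʳ : ∀ {n m p} (e : n + m ≡ suc p) (i : Fin n) (x : Element n) {y : Element m} →
              Ideal y → Ideal (comp e i x y)

    infix 4 _∼_

    _∼_ : ∀ {n} → Element n → Element n → Set (c ⊔ m ⊔ ℓ ⊔ r)
    x ∼ y = Ideal (x +ᴹ -ᴹ y)

    private
      module _ {n : ℕ} where
        open AbelianGroupProperties (+ᴹ-abelianGroup {n}) public
          using (⁻¹-∙-comm; ⁻¹-involutive; inverseʳ-unique; ∙-cancelʳ; //-rightDividesˡ)
        open CommutativeSemigroupProperties
          (CommutativeMonoid.commutativeSemigroup (+ᴹ-commutativeMonoid {n})) public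
          using (interchange)

      module _ {n : ℕ} where
        open SetoidReasoning (≈ᴹ-setoid {n})

        ≈⇒∼ : {x y : Element n} → x ≈ᴹ y → x ∼ y
        ≈⇒∼ {x} {y} p = resp (≈ᴹ-sym (≈ᴹ-trans (+ᴹ-congʳ p) (-ᴹ‿inverseʳ y))) zero

        neg-scale : (x : Element n) → (K.- 1#) *ₗ x ≈ᴹ -ᴹ x
        neg-scale x = inverseʳ-unique x _ (begin
          x +ᴹ (K.- 1#) *ₗ x          ≈⟨ +ᴹ-congʳ (*ₗ-identityˡ x) ⟨
          1# *ₗ x +ᴹ (K.- 1#) *ₗ x    ≈⟨ *ₗ-distribʳ x 1# (K.- 1#) ⟨
          (1# K.+ K.- 1#) *ₗ x        ≈⟨ *ₗ-congʳ (K.-‿inverseʳ 1#) ⟩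
          0# *ₗ x                     ≈⟨ *ₗ-zeroˡ x ⟩
          0ᴹ                          ∎)

        neg : {x : Element n} → Ideal x → Ideal (-ᴹ x)
        neg {x} p = resp (neg-scale x) (scale (K.- 1#) p)

        ∼-sym : {x y : Element n} → x ∼ y → y ∼ x
        ∼-sym {x} {y} p = resp (begin
          -ᴹ (x +ᴹ -ᴹ y)        ≈⟨ ⁻¹-∙-comm x (-ᴹ y) ⟨
          -ᴹ x +ᴹ -ᴹ (-ᴹ y)     ≈⟨ +ᴹ-congˡ (⁻¹-involutive y) ⟩
          -ᴹ x +ᴹ y             ≈⟨ +ᴹ-comm _ _ ⟩
          y +ᴹ -ᴹ x             ∎) (neg p)

        ∼-trans : {x y z : Element n} → x ∼ y → y ∼ z → x ∼ z
        ∼-trans {x} {y} {z} p q = resp (begin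
          (x +ᴹ -ᴹ y) +ᴹ (y +ᴹ -ᴹ z)  ≈⟨ +ᴹ-assoc _ y _ ⟨
          ((x +ᴹ -ᴹ y) +ᴹ y) +ᴹ -ᴹ z  ≈⟨ +ᴹ-congʳ (//-rightDividesˡ y x) ⟩
          x +ᴹ -ᴹ z                   ∎) (add p q)

        ∼-add : {x x′ y y′ : Element n} → x ∼ x′ → y ∼ y′ → (x +ᴹ y) ∼ (x′ +ᴹ y′)
        ∼-add {x} {x′} {y} {y′} p q = resp (begin
          (x +ᴹ -ᴹ x′) +ᴹ (y +ᴹ -ᴹ y′)  ≈⟨ interchange _ _ _ _ ⟩
          (x +ᴹ y) +ᴹ (-ᴹ x′ +ᴹ -ᴹ y′)  ≈⟨ +ᴹ-congˡ (⁻¹-∙-comm x′ y′) ⟩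
          (x +ᴹ y) +ᴹ -ᴹ (x′ +ᴹ y′)     ∎) (add p q)

        ∼-neg : {x y : Element n} → x ∼ y → (-ᴹ x) ∼ (-ᴹ y)
        ∼-neg {x} {y} p = resp (≈ᴹ-sym (⁻¹-∙-comm x (-ᴹ y))) (neg p)

        ∼-scaleʳ : ∀ a {x y : Element n} → x ∼ y → (a *ₗ x) ∼ (a *ₗ y)
        ∼-scaleʳ a {x} {y} p = resp (begin
          a *ₗ (x +ᴹ -ᴹ y)        ≈⟨ *ₗ-distribˡ a x _ ⟩
          a *ₗ x +ᴹ a *ₗ (-ᴹ y)   ≈⟨ +ᴹ-congˡ (inverseʳ-unique (a *ₗ y) _ (begin
            a *ₗ y +ᴹ a *ₗ (-ᴹ y)   ≈⟨ *ₗ-distribˡ a y _ ⟨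
            a *ₗ (y +ᴹ -ᴹ y)        ≈⟨ *ₗ-congˡ (-ᴹ‿inverseʳ y) ⟩
            a *ₗ 0ᴹ                 ≈⟨ *ₗ-zeroʳ a ⟩
            0ᴹ                      ∎)) ⟩
          a *ₗ x +ᴹ -ᴹ (a *ₗ y)   ∎) (scale a p)

        ∼-scale : ∀ {a b} {x y : Element n} → a K.≈ b → x ∼ y → (a *ₗ x) ∼ (b *ₗ y)
        ∼-scale {a} {b} a≈b p = ∼-trans (∼-scaleʳ a p) (≈⇒∼ (*ₗ-congʳ a≈b))

      sub-unique : ∀ {n} {u v w : Element n} → u +ᴹ v ≈ᴹ w → u ≈ᴹ w +ᴹ -ᴹ v
      sub-unique {u = u} {v} {w} p =
        ∙-cancelʳ v _ _ (≈ᴹ-trans p (≈ᴹ-sym (//-rightDividesˡ v w)))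

      ∼-compˡ : ∀ {n m p} (e : n + m ≡ suc p) (i : Fin n) {x x′ : Element n} (y : Element m) →
                x ∼ x′ → comp e i x y ∼ comp e i x′ y
      ∼-compˡ e i {x} {x′} y p = resp (sub-unique (≈ᴹ-trans (≈ᴹ-sym (comp-addˡ e i _ x′ y))
        (comp-cong e i (//-rightDividesˡ x′ x) ≈ᴹ-refl))) (compˡ e i y p)

      ∼-compʳ : ∀ {n m p} (e : n + m ≡ suc p) (i : Fin n) (x : Element n) {y y′ : Element m} →
                y ∼ y′ → comp e i x y ∼ comp e i x y′
      ∼-compʳ e i x {y} {y′} p = resp (sub-unique (≈ᴹ-trans (≈ᴹ-sym (comp-addʳ e i x _ y′))
        (comp-cong e i ≈ᴹ-refl (//-rightDividesˡ y′ y)))) (compʳ e i x p)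

    _/⟨_⟩ : Operad m (c ⊔ m ⊔ ℓ ⊔ r)
    _/⟨_⟩ = record
      { component = λ n → record
        { Carrierᴹ = Element n
        ; _≈ᴹ_     = _∼_
        ; _+ᴹ_     = _+ᴹ_
        ; _*ₗ_     = _*ₗ_
        ; 0ᴹ       = 0ᴹ
        ; -ᴹ_      = -ᴹ_
        ; isLeftModule = record
          { isLeftSemimodule = record
            { +ᴹ-isCommutativeMonoid = record
              { isMonoid = record
                { isSemigroup = record
                  { isMagma = record
                    { isEquivalence = record
                      { refl = ≈⇒∼ ≈ᴹ-refl ; sym = ∼-sym ; trans = ∼-trans }
                    ; ∙-cong = ∼-add
                    }
                  ; assoc = λ x y z → ≈⇒∼ (+ᴹ-assoc x y z)
                  }
                ; identity = (λ x → ≈⇒∼ (+ᴹ-identityˡ x)) , (λ x → ≈⇒∼ (+ᴹ-identityʳ x))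
                }
              ; comm = λ x y → ≈⇒∼ (+ᴹ-comm x y)
              }
            ; isPreleftSemimodule = record
              { *ₗ-cong      = ∼-scale
              ; *ₗ-zeroˡ     = λ x → ≈⇒∼ (*ₗ-zeroˡ x)
              ; *ₗ-distribʳ  = λ x a b → ≈⇒∼ (*ₗ-distribʳ x a b)
              ; *ₗ-identityˡ = λ x → ≈⇒∼ (*ₗ-identityˡ x)
              ; *ₗ-assoc     = λ a b x → ≈⇒∼ (*ₗ-assoc a b x)
              ; *ₗ-zeroʳ     = λ a → ≈⇒∼ (*ₗ-zeroʳ a)
              ; *ₗ-distribˡ  = λ a x y → ≈⇒∼ (*ₗ-distribˡ a x y)
              }
            }
          ; -ᴹ‿cong    = ∼-neg
          ; -ᴹ‿inverse = (λ x → ≈⇒∼ (-ᴹ‿inverseˡ x)) , (λ x → ≈⇒∼ (-ᴹ‿inverseʳ x))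
          }
        }
      ; 𝟏           = 𝟏
      ; comp        = comp
      ; comp-cong   = λ e i {x} {x′} {y} {y′} p q → ∼-trans (∼-compˡ e i y p) (∼-compʳ e i x′ q)
      ; comp-addˡ   = λ e i x x′ y → ≈⇒∼ (comp-addˡ e i x x′ y)
      ; comp-scaleˡ = λ e i a x y → ≈⇒∼ (comp-scaleˡ e i a x y)
      ; comp-addʳ   = λ e i x y y′ → ≈⇒∼ (comp-addʳ e i x y y′)
      ; comp-scaleʳ = λ e i x a y → ≈⇒∼ (comp-scaleʳ e i x a y)
      ; identityˡ   = λ e y → ≈⇒∼ (identityˡ e y)
      ; identityʳ   = λ e i x → ≈⇒∼ (identityʳ e i x)
      ; sequential  = λ e₁ e₂ e₃ e₄ i j k p x y z → ≈⇒∼ (sequential e₁ e₂ e₃ e₄ i j k p x y z)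
      ; parallel    = λ e₁ e₂ e₃ e₄ i k k′ i′ p q s x y z →
                        ≈⇒∼ (parallel e₁ e₂ e₃ e₄ i k k′ i′ p q s x y z)
      }
    -- The quotient has the same elements and a coarser equality.
    quotientMap : ∀ {n} → Element n → Operad.Element _/⟨_⟩ n
    quotientMap x = x

  module _ (Gen : Set) where
    private
      V : ℕ → VectorSpace c (c ⊔ ℓ₁)
      V n = freeVectorSpace (Tree Gen n)

      composeTrees : ∀ {n m p} → n + m ≡ suc p → Fin n → Tree Gen n → Tree Gen m → Lin (Tree Gen p)
      composeTrees e i t u = var (graftTree e i t u)

      compose : ∀ {n m p} → n + m ≡ suc p → Fin n →
                Lin (Tree Gen n) → Lin (Tree Gen m) → Lin (Tree Gen p)
      compose {p = p} e i = extend₂ (V p) (composeTrees e i)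

      compose-identityˡ : ∀ {m} (e : 1 + m ≡ suc m) y → compose e zero (var identityTree) y ≋ y
      compose-identityˡ e (var u) = ≋-refl
      compose-identityˡ e 𝟘       = ≋-refl
      compose-identityˡ e (x ⊕ y) = ⊕-cong (compose-identityˡ e x) (compose-identityˡ e y)
      compose-identityˡ e (a · x) = ·-cong K.refl (compose-identityˡ e x)

      ≡⇒≋ : ∀ {X : Set} {s t : X} → s ≡ t → var s ≋ var t
      ≡⇒≋ refl = ≋-refl

      compose-identityʳ : ∀ {n} (e : n + 1 ≡ suc n) i x → compose e i x (var identityTree) ≋ x
      compose-identityʳ e i (var (mkTree t a)) = ≡⇒≋ (shape-injective (graft-identityʳ t (toℕ i)))
      compose-identityʳ e i 𝟘       = ≋-refl
      compose-identityʳ e i (x ⊕ y) = ⊕-cong (compose-identityʳ e i x) (compose-identityʳ e i y)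
      compose-identityʳ e i (a · x) = ·-cong K.refl (compose-identityʳ e i x)

      module _ {n m l p q r : ℕ} (e₁ : n + m ≡ suc p) (e₂ : p + l ≡ suc r)
               (e₃ : m + l ≡ suc q) (e₄ : n + q ≡ suc r)
               (i : Fin n) (j : Fin m) (k : Fin p) (k≡ : toℕ k ≡ toℕ i + toℕ j) where

        compose-sequential : ∀ x y z →
          compose e₂ k (compose e₁ i x y) z ≋ compose e₄ i x (compose e₃ j y z)
        compose-sequential (x ⊕ x′) y z =
          ⊕-cong (compose-sequential x y z) (compose-sequential x′ y z)
        compose-sequential (a · x)  y z = ·-cong K.refl (compose-sequential x y z)
        compose-sequential 𝟘        y z = ≋-refl
        compose-sequential (var t) (y ⊕ y′) z =
          ⊕-cong (compose-sequential (var t) y z) (compose-sequential (var t) y′ z)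
        compose-sequential (var t) (a · y)  z = ·-cong K.refl (compose-sequential (var t) y z)
        compose-sequential (var t) 𝟘        z = ≋-refl
        compose-sequential (var t) (var u) (z ⊕ z′) =
          ⊕-cong (compose-sequential (var t) (var u) z) (compose-sequential (var t) (var u) z′)
        compose-sequential (var t) (var u) (a · z) =
          ·-cong K.refl (compose-sequential (var t) (var u) z)
        compose-sequential (var t) (var u) 𝟘 = ≋-refl
        compose-sequential (var t) (var u) (var v) =
          ≡⇒≋ (graftTree-sequential e₁ e₂ e₃ e₄ i j k k≡ t u v)

      module _ {n m l p q r : ℕ} (e₁ : n + m ≡ suc p) (e₂ : p + l ≡ suc r)
               (e₃ : n + l ≡ suc q) (e₄ : q + m ≡ suc r)
               (i k : Fin n) (k′ : Fin p) (i′ : Fin q)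
               (i<k : toℕ i < toℕ k) (k′≡ : suc (toℕ k′) ≡ toℕ k + m) (i′≡ : toℕ i′ ≡ toℕ i) where

        compose-parallel : ∀ x y z →
          compose e₂ k′ (compose e₁ i x y) z ≋ compose e₄ i′ (compose e₃ k x z) y
        compose-parallel (x ⊕ x′) y z =
          ⊕-cong (compose-parallel x y z) (compose-parallel x′ y z)
        compose-parallel (a · x)  y z = ·-cong K.refl (compose-parallel x y z)
        compose-parallel 𝟘        y z = ≋-refl
        compose-parallel (var t) (y ⊕ y′) z = ≋-trans
          (⊕-cong (compose-parallel (var t) y z) (compose-parallel (var t) y′ z))
          (≋-sym (extend₂-addʳ (V r) (composeTrees e₄ i′) (compose e₃ k (var t) z) y y′))
        compose-parallel (var t) (a · y)  z = ≋-trans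
          (·-cong K.refl (compose-parallel (var t) y z))
          (≋-sym (extend₂-scaleʳ (V r) (composeTrees e₄ i′) (compose e₃ k (var t) z) a y))
        compose-parallel (var t) 𝟘        z =
          ≋-sym (extend₂-zeroʳ (V r) (composeTrees e₄ i′) (compose e₃ k (var t) z))
        compose-parallel (var t) (var u) (z ⊕ z′) =
          ⊕-cong (compose-parallel (var t) (var u) z) (compose-parallel (var t) (var u) z′)
        compose-parallel (var t) (var u) (a · z) =
          ·-cong K.refl (compose-parallel (var t) (var u) z)
        compose-parallel (var t) (var u) 𝟘 = ≋-refl
        compose-parallel (var t) (var u) (var v) =
          ≡⇒≋ (graftTree-parallel e₁ e₂ e₃ e₄ i k k′ i′ i<k k′≡ i′≡ t u v)

    Free : Operad c (c ⊔ ℓ₁)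
    Free = record
      { component   = V
      ; 𝟏           = var identityTree
      ; comp        = compose
      ; comp-cong   = λ {_} {_} {p} e i → extend₂-cong (V p) (composeTrees e i)
      ; comp-addˡ   = λ _ _ _ _ _ → ≋-refl
      ; comp-scaleˡ = λ _ _ _ _ _ → ≋-refl
      ; comp-addʳ   = λ {_} {_} {p} e i → extend₂-addʳ (V p) (composeTrees e i)
      ; comp-scaleʳ = λ {_} {_} {p} e i → extend₂-scaleʳ (V p) (composeTrees e i)
      ; identityˡ   = compose-identityˡ
      ; identityʳ   = compose-identityʳ
      ; sequential  = compose-sequential
      ; parallel    = compose-parallel
      }

  generator : ∀ {Gen} → Gen → Operad.Element (Free Gen) 2
  generator x = var (corolla x)

  record Presentation (r : Level) : Set (lsuc (c ⊔ r)) where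
    field
      Gen  : Set
      _≟_  : DecidableEquality Gen
      Rels : Pred (Operad.Element (Free Gen) 3) r

  module _ {r : Level} (Q : Presentation r) where
    open Presentation Q
    open Operad (Free Gen) using (Element)

    presented : Operad c (c ⊔ ℓ₁ ⊔ r)
    presented = Free Gen /⟨ Rels ⟩

    -- The trees node x (node y leaf leaf) leaf and node x leaf (node y leaf leaf)
    -- are x ∘₁ y and x ∘₂ y; they exhaust the trees of arity 3.
    treeForm : BinTree Gen → BinTree Gen → K.Carrier
    treeForm (node x (node y leaf leaf) leaf) (node x′ (node y′ leaf leaf) leaf) =
      if does (x ≟ x′) ∧ does (y ≟ y′) then 1# else 0#
    treeForm (node x leaf (node y leaf leaf)) (node x′ leaf (node y′ leaf leaf)) =
      if does (x ≟ x′) ∧ does (y ≟ y′) then K.- 1# else 0#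
    treeForm _ _ = 0#

    ⟪_,_⟫ : Element 3 → Element 3 → K.Carrier
    ⟪_,_⟫ = extend₂ (leftModule {R = K.ring}) (λ t u → treeForm (Tree.shape t) (Tree.shape u))

    Rels⊥ : Pred (Element 3) (c ⊔ ℓ₁ ⊔ r)
    Rels⊥ f = ∀ {g} → g ∈ Rels → ⟪ g , f ⟫ K.≈ 0#

    koszulDual : Operad c (c ⊔ ℓ₁ ⊔ r)
    koszulDual = Free Gen /⟨ Rels⊥ ⟩

  -- The integer a in {1, …, γ} is represented by the element of Fin γ with
  -- value a ∸ 1.
  data DiasGen (γ : ℕ) : Set where
    ⊣ ⊢ : Fin γ → DiasGen γ

  ⊣-injective : ∀ {γ} {a b : Fin γ} → ⊣ a ≡ ⊣ b → a ≡ b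
  ⊣-injective refl = refl

  ⊢-injective : ∀ {γ} {a b : Fin γ} → ⊢ a ≡ ⊢ b → a ≡ b
  ⊢-injective refl = refl

  _≟ᴰ_ : ∀ {γ} → DecidableEquality (DiasGen γ)
  ⊣ a ≟ᴰ ⊣ b = map′ (cong ⊣) ⊣-injective (a Fin.≟ b)
  ⊢ a ≟ᴰ ⊢ b = map′ (cong ⊢) ⊢-injective (a Fin.≟ b)
  ⊣ _ ≟ᴰ ⊢ _ = no λ ()
  ⊢ _ ≟ᴰ ⊣ _ = no λ ()

  module _ (γ : ℕ) where
    open Max (Fin.≤-totalOrder γ) using () renaming (_⊔_ to _↑_)
    open Operad (Free (DiasGen γ)) using (Element; component; _∘₁_; _∘₂_; _+ᴹ_; -ᴹ_)

    private
      ⟨⊣_⟩ ⟨⊢_⟩ : Fin γ → Element 2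
      ⟨⊣ a ⟩ = generator (⊣ a)
      ⟨⊢ a ⟩ = generator (⊢ a)

    data DiasRelation : Pred (Element 3) c where
      rel₁ : ∀ a a′ → DiasRelation (⟨⊣ a ⟩ ∘₁ ⟨⊢ a′ ⟩ +ᴹ -ᴹ (⟨⊢ a′ ⟩ ∘₂ ⟨⊣ a ⟩))
      rel₂ : ∀ a a′ → DiasRelation (⟨⊣ a ⟩ ∘₁ ⟨⊣ a ↑ a′ ⟩ +ᴹ -ᴹ (⟨⊣ a ⟩ ∘₂ ⟨⊢ a′ ⟩))
      rel₃ : ∀ a a′ → DiasRelation (⟨⊢ a ⟩ ∘₁ ⟨⊣ a′ ⟩ +ᴹ -ᴹ (⟨⊢ a ⟩ ∘₂ ⟨⊢ a ↑ a′ ⟩))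
      rel₄ : ∀ a a′ → DiasRelation (⟨⊣ a ↑ a′ ⟩ ∘₁ ⟨⊣ a ⟩ +ᴹ -ᴹ (⟨⊣ a ⟩ ∘₂ ⟨⊣ a′ ⟩))
      rel₅ : ∀ a a′ → DiasRelation (⟨⊢ a ⟩ ∘₁ ⟨⊢ a′ ⟩ +ᴹ -ᴹ (⟨⊢ a ↑ a′ ⟩ ∘₂ ⟨⊢ a ⟩))

    diasPresentation : Presentation (c ⊔ ℓ₁)
    diasPresentation = record
      { Gen  = DiasGen γ
      ; _≟_  = _≟ᴰ_
      ; Rels = Span (component 3) DiasRelation
      }

    Dias : Operad c (c ⊔ ℓ₁)
    Dias = presented diasPresentation

    Dendr : Operad c (c ⊔ ℓ₁)
    Dendr = koszulDual diasPresentation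

    π : ∀ {n} → Element n → Operad.Element Dendr n
    π = quotientMap (Free (DiasGen γ)) (Rels⊥ diasPresentation)

  pattern ↼ a = ⊣ a
  pattern ⇀ a = ⊢ a

  • : ∀ {γ} → Fin γ → Operad.Element (Dendr γ) 2
  • {γ} b = π γ (foldr _+ᴹ_ 0ᴹ
      (map (λ a → generator (↼ a) +ᴹ generator (⇀ a)) (filter (Fin._≤? b) (allFin γ))))
    where open Operad (Free (DiasGen γ)) using (_+ᴹ_; 0ᴹ)

{-# OPTIONS --safe #-}
-- The coefficient of •_b on ↼_a and on ⇀_a is the indicator e_a of a ≤ b, and
-- u ∘₁ u − u ∘₂ u pairs with x ∘₁ y − x′ ∘₂ y′ to χ x · χ y − χ x′ · χ y′, where
-- χ reads off the coefficients of u.  On the relations of Dias_γ this vanishes for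
-- u = •_b because e_{a ↑ a′} = e_a e_a′ and e_a is idempotent.  So the associator
-- of •_b is itself one of the relations of the Koszul dual.
module Submission where

open import Defs
open import Algebra.Apartness.Bundles using (HeytingField)
open import Algebra.Bundles using (CommutativeRing)
open import Algebra.Module.Construct.TensorUnit using (leftModule)
open import Data.Bool.Base using (Bool; true; false; if_then_else_; _∧_)
open import Data.Fin.Base as Fin using (Fin)
open import Data.Fin.Properties as Fin using ()
open import Data.List.Base using (List; []; _∷_; foldr; map; filter; allFin)
open import Data.List.Membership.Propositional using (_∈_; _∉_)
open import Data.List.Membership.Propositional.Properties using (∈-allFin; ∈-filter⁺; ∈-filter⁻)
open import Data.List.Relation.Unary.All.Properties using (All¬⇒¬Any)
open import Data.List.Relation.Unary.AllPairs using (_∷_)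
open import Data.List.Relation.Unary.Any using (here; there)
open import Data.List.Relation.Unary.Unique.Propositional using (Unique)
open import Data.List.Relation.Unary.Unique.Propositional.Properties using (allFin⁺; filter⁺)
open import Data.Nat.Base using (ℕ; _≤_; s≤s; z≤n)
open import Data.Nat.Properties as ℕ using ()
open import Data.Product.Base using (∃; _×_; _,_; proj₂)
open import Function.Base using (_∘_)
open import Function.Bundles using (_⇔_; mk⇔)
open import Level using (Level)
open import Relation.Binary.PropositionalEquality using (_≡_; refl; sym; cong)
open import Relation.Nullary using (¬_; Dec; yes; no; does; contradiction; recompute)
open import Relation.Nullary.Decidable using (_×-dec_; does-⇔)
import Algebra.Construct.NaturalChoice.Max as Max
import Algebra.Properties.Group as GroupProperties
import Algebra.Properties.Ring as RingProperties
import Relation.Binary.Reasoning.Setoid as SetoidReasoning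

-- Trees of arity 2.

module _ {Gen : Set} where

  1≤leaves : (t : BinTree Gen) → 1 ≤ leaves t
  1≤leaves leaf         = s≤s z≤n
  1≤leaves (node x l r) = ℕ.≤-trans (1≤leaves l) (ℕ.m≤m+n _ (leaves r))

  2≤leaves-node : ∀ (x : Gen) l r → 2 ≤ leaves (node x l r)
  2≤leaves-node x l r = ℕ.+-mono-≤ (1≤leaves l) (1≤leaves r)

  -- A node below the root already forces at least three leaves. The arity proof is irrelevant, so
  -- it is recovered by `recompute` from decidable equality on the naturals. Pairings can thus be
  -- checked on corollas alone.
  corolla-surjective : (t : Tree Gen 2) → ∃ λ x → t ≡ corolla x
  corolla-surjective (mkTree (node x leaf leaf) _) = x , refl
  corolla-surjective (mkTree (node x leaf (node y l r)) a) =
    contradiction (sym (recompute (_ ℕ.≟ _) a)) (ℕ.<⇒≢ (s≤s (2≤leaves-node y l r)))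
  corolla-surjective (mkTree (node x (node y l m) r) a) =
    contradiction (sym (recompute (_ ℕ.≟ _) a))
      (ℕ.<⇒≢ (ℕ.+-mono-≤ (2≤leaves-node y l m) (1≤leaves r)))

module _ {c ℓ₁ ℓ₂ : Level} (K : HeytingField c ℓ₁ ℓ₂) where
  open OverField K

  private
    module K where
      open CommutativeRing (heytingField⇒commutativeRing K) public
      open RingProperties ring public using (-1*x≈-x)
      open GroupProperties +-group public using ()
        renaming (⁻¹-involutive to -‿involutive; ε⁻¹≈ε to -0≈0)

  open K using (0#; 1#)
  open SetoidReasoning K.setoid

  -- Functionals on free vector spaces.

  linear : ∀ {X : Set} → (X → K.Carrier) → Lin X → K.Carrier
  linear = extend (leftModule {R = K.ring})

  iverson : Bool → K.Carrier
  iverson p = if p then 1# else 0#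

  iverson-∧ : ∀ p q → iverson (p ∧ q) K.≈ iverson p K.* iverson q
  iverson-∧ false q = K.sym (K.zeroˡ _)
  iverson-∧ true  q = K.sym (K.*-identityˡ _)

  iverson-idempotent : ∀ p → iverson p K.* iverson p K.≈ iverson p
  iverson-idempotent true  = K.*-identityˡ 1#
  iverson-idempotent false = K.zeroˡ 0#

  ≈-iverson : ∀ {a} {A : Set a} (A? : Dec A) {x} →
              (A → x K.≈ 1#) → (¬ A → x K.≈ 0#) → x K.≈ iverson (does A?)
  ≈-iverson (yes a) x≈1 _   = x≈1 a
  ≈-iverson (no ¬a) _   x≈0 = x≈0 ¬a

  -- Both sides are bilinear in `u` and `v`, so agreement on basis elements suffices. The factor `k`
  -- lets one statement serve every block of the form: `1#`, `0#` and `- 1#`.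
  linear-extend₂ : ∀ {X Y Z : Set} (φ : Z → K.Carrier) (α : X → K.Carrier) (β : Y → K.Carrier)
    (f : X → Y → Lin Z) k → (∀ s t → linear φ (f s t) K.≈ k K.* (α s K.* β t)) →
    ∀ u v → linear φ (extend₂ (freeVectorSpace Z) f u v) K.≈ k K.* (linear α u K.* linear β v)
  linear-extend₂ φ α β f k φf≈ = go
    where
    scaleOut : ∀ a x → a K.* (k K.* x) K.≈ k K.* (a K.* x)
    scaleOut a x = K.trans (K.sym (K.*-assoc a k x))
      (K.trans (K.*-congʳ (K.*-comm a k)) (K.*-assoc k a x))

    right : ∀ s v → linear φ (extend (freeVectorSpace _) (f s) v) K.≈ k K.* (α s K.* linear β v)
    right s (var t) = φf≈ s t
    right s 𝟘       = K.sym (K.trans (K.*-congˡ (K.zeroʳ _)) (K.zeroʳ _))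
    right s (v ⊕ w) = K.trans (K.+-cong (right s v) (right s w))
      (K.sym (K.trans (K.*-congˡ (K.distribˡ _ _ _)) (K.distribˡ _ _ _)))
    right s (a · v) = K.trans (K.*-congˡ (right s v)) (K.trans (scaleOut a _) (K.*-congˡ
      (K.trans (K.sym (K.*-assoc a _ _)) (K.trans (K.*-congʳ (K.*-comm a _)) (K.*-assoc _ a _)))))

    go : ∀ u v → linear φ (extend₂ (freeVectorSpace _) f u v) K.≈ k K.* (linear α u K.* linear β v)
    go (var s) v = right s v
    go 𝟘       v = K.sym (K.trans (K.*-congˡ (K.zeroˡ _)) (K.zeroʳ _))
    go (u ⊕ w) v = K.trans (K.+-cong (go u v) (go w v))
      (K.sym (K.trans (K.*-congˡ (K.distribʳ _ _ _)) (K.distribˡ _ _ _)))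
    go (a · u) v = K.trans (K.*-congˡ (go u v))
      (K.trans (scaleOut a _) (K.*-congˡ (K.sym (K.*-assoc a _ _))))

  -- The pairing in arity 3, for an arbitrary presentation.

  module _ {r : Level} (Q : Presentation r) where
    open Presentation Q
    open Operad (Free Gen) using (Element; _∘₁_; _∘₂_; _+ᴹ_; -ᴹ_)

    pairing : Element 3 → Element 3 → K.Carrier
    pairing = ⟪_,_⟫ Q

    rootIs : Gen → BinTree Gen → K.Carrier
    -- A filler value: a tree of arity 2 is never a leaf.
    rootIs x leaf         = 0#
    rootIs x (node y _ _) = iverson (does (x ≟ y))

    indicator : Gen → Tree Gen 2 → K.Carrier
    indicator x t = rootIs x (Tree.shape t)

    coefficient : Gen → Element 2 → K.Carrier
    coefficient x = linear (indicator x)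

    module _ (x y : Gen) (u v : Element 2) where

      -- On corollas the form is the indicator of a conjunction, which factors into one indicator
      -- per generator; bilinearity turns these into coefficients.
      pairing-∘₁-∘₁ : pairing (generator x ∘₁ generator y) (u ∘₁ v) K.≈
                      coefficient x u K.* coefficient y v
      pairing-∘₁-∘₁ = K.trans (linear-extend₂ _ _ _ _ 1# onTrees u v) (K.*-identityˡ _)
        where
        onTrees : ∀ s t → _ K.≈ 1# K.* (_ K.* _)
        onTrees s t with corolla-surjective s | corolla-surjective t
        ... | x′ , refl | y′ , refl =
          K.trans (iverson-∧ (does (x ≟ x′)) _) (K.sym (K.*-identityˡ _))

      pairing-∘₁-∘₂ : pairing (generator x ∘₁ generator y) (u ∘₂ v) K.≈ 0#
      pairing-∘₁-∘₂ = K.trans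
        -- Trees of different shapes are orthogonal, hence `k` is `0#`. It annihilates the product
        -- of functionals, so the conclusion does not determine them and they are named.
        (linear-extend₂ _ (indicator x) (indicator y) _ 0# onTrees u v) (K.zeroˡ _)
        where
        onTrees : ∀ s t → _ K.≈ 0# K.* (_ K.* _)
        onTrees s t with corolla-surjective s | corolla-surjective t
        ... | x′ , refl | y′ , refl = K.sym (K.zeroˡ _)

      pairing-∘₂-∘₁ : pairing (generator x ∘₂ generator y) (u ∘₁ v) K.≈ 0#
      pairing-∘₂-∘₁ = K.trans
        (linear-extend₂ _ (indicator x) (indicator y) _ 0# onTrees u v) (K.zeroˡ _)
        where
        onTrees : ∀ s t → _ K.≈ 0# K.* (_ K.* _)
        onTrees s t with corolla-surjective s | corolla-surjective t
        ... | x′ , refl | y′ , refl = K.sym (K.zeroˡ _)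

      pairing-∘₂-∘₂ : pairing (generator x ∘₂ generator y) (u ∘₂ v) K.≈
                      K.- (coefficient x u K.* coefficient y v)
      pairing-∘₂-∘₂ = K.trans (linear-extend₂ _ _ _ _ (K.- 1#) onTrees u v) (K.-1*x≈-x _)
        where
        negate : ∀ p → (if p then K.- 1# else 0#) K.≈ K.- 1# K.* iverson p
        negate true  = K.sym (K.*-identityʳ _)
        negate false = K.sym (K.zeroʳ _)
        onTrees : ∀ s t → _ K.≈ K.- 1# K.* (_ K.* _)
        onTrees s t with corolla-surjective s | corolla-surjective t
        ... | x′ , refl | y′ , refl =
          K.trans (negate (does (x ≟ x′) ∧ _)) (K.*-congˡ (iverson-∧ (does (x ≟ x′)) _))

    associator : Element 2 → Element 3
    associator u = u ∘₁ u +ᴹ -ᴹ (u ∘₂ u)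

    -- The mixed pairings vanish. The surviving `∘₂` term carries three signs, from the relation,
    -- the associator and the form, so the total is a difference of two products of coefficients.
    associator-orthogonal : ∀ u x y x′ y′ →
      coefficient x u K.* coefficient y u K.≈ coefficient x′ u K.* coefficient y′ u →
      pairing (generator x ∘₁ generator y +ᴹ -ᴹ (generator x′ ∘₂ generator y′)) (associator u) K.≈ 0#
    associator-orthogonal u x y x′ y′ eq = begin
      -- Negation in the free vector space is scaling by `- 1#`, and composites of generators are
      -- single basis trees, so the pairing computes to this expression.
      (p₁₁ K.+ K.- 1# K.* p₁₂) K.+ K.- 1# K.* (p₂₁ K.+ K.- 1# K.* p₂₂)
        ≈⟨ K.+-cong (K.+-congˡ (K.-1*x≈-x p₁₂))
             (K.trans (K.-1*x≈-x _) (K.-‿cong (K.+-congˡ (K.-1*x≈-x p₂₂)))) ⟩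
      (p₁₁ K.- p₁₂) K.- (p₂₁ K.- p₂₂)
        ≈⟨ K.+-cong (K.+-cong (pairing-∘₁-∘₁ x y u u) (K.-‿cong (pairing-∘₁-∘₂ x y u u)))
             (K.-‿cong (K.+-cong (pairing-∘₂-∘₁ x′ y′ u u) (K.-‿cong (pairing-∘₂-∘₂ x′ y′ u u)))) ⟩
      (p K.- 0#) K.- (0# K.- (K.- q))
        ≈⟨ K.+-cong (K.trans (K.+-congˡ K.-0≈0) (K.+-identityʳ p))
             (K.-‿cong (K.trans (K.+-identityˡ _) (K.-‿involutive q))) ⟩
      p K.- q  ≈⟨ K.+-congʳ eq ⟩
      q K.- q  ≈⟨ K.-‿inverseʳ q ⟩
      0#       ∎
      where
      p₁₁ = pairing (generator x ∘₁ generator y) (u ∘₁ u)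
      p₁₂ = pairing (generator x ∘₁ generator y) (u ∘₂ u)
      p₂₁ = pairing (generator x′ ∘₂ generator y′) (u ∘₁ u)
      p₂₂ = pairing (generator x′ ∘₂ generator y′) (u ∘₂ u)
      p = coefficient x u K.* coefficient y u
      q = coefficient x′ u K.* coefficient y′ u

  -- Coefficients of sums of generators.

  module _ {γ : ℕ} where
    open Operad (Free (DiasGen γ)) using (Element; _∘₁_; _∘₂_; _+ᴹ_; -ᴹ_; 0ᴹ)
    open Max (Fin.≤-totalOrder γ) using (x⊔y≤z⇒x≤z; x⊔y≤z⇒y≤z; ⊔-lub) renaming (_⊔_ to _↑_)

    multiplicity : Fin γ → List (Fin γ) → K.Carrier
    multiplicity a = foldr (λ d k → iverson (does (a Fin.≟ d)) K.+ k) 0#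

    multiplicity-∉ : ∀ {a} L → a ∉ L → multiplicity a L K.≈ 0#
    multiplicity-∉ []      a∉L = K.refl
    multiplicity-∉ {a} (d ∷ L) a∉L with a Fin.≟ d
    ... | yes a≡d = contradiction (here a≡d) a∉L
    ... | no  _   = K.trans (K.+-identityˡ _) (multiplicity-∉ L (a∉L ∘ there))

    -- In a list without repetitions, a head equal to `a` is absent from the tail, so exactly one
    -- summand is `1#`.
    multiplicity-∈ : ∀ {a} L → Unique L → a ∈ L → multiplicity a L K.≈ 1#
    multiplicity-∈ {a} (d ∷ L) (d∉L ∷ L!) a∈L with a Fin.≟ d | a∈L
    ... | yes refl | _          =
      K.trans (K.+-congˡ (multiplicity-∉ L (All¬⇒¬Any d∉L))) (K.+-identityʳ 1#)
    ... | no a≢d   | here a≡d   = contradiction a≡d a≢d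
    ... | no _     | there a∈L′ = K.trans (K.+-identityˡ _) (multiplicity-∈ L L! a∈L′)

    -- The sum defining `•`, over an arbitrary list so that induction applies.
    generatorSum : List (Fin γ) → Element 2
    generatorSum L = foldr _+ᴹ_ 0ᴹ (map (λ a → generator (↼ a) +ᴹ generator (⇀ a)) L)

    χ : DiasGen γ → Element 2 → K.Carrier
    χ = coefficient (diasPresentation γ)

    index : DiasGen γ → Fin γ
    index (↼ a) = a
    index (⇀ a) = a

    χ-generatorSum : ∀ x L → χ x (generatorSum L) K.≈ multiplicity (index x) L
    χ-generatorSum x     []      = K.refl
    -- Each summand holds one generator of either kind; the one of the other kind contributes `0#`
    -- by computation.
    χ-generatorSum (↼ a) (d ∷ L) = K.+-cong (K.+-identityʳ _) (χ-generatorSum (↼ a) L)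
    χ-generatorSum (⇀ a) (d ∷ L) = K.+-cong (K.+-identityˡ _) (χ-generatorSum (⇀ a) L)

    -- Orthogonality of the associator of `• b` to the relations.

    module _ (b : Fin γ) where

      [_≤b] : Fin γ → K.Carrier
      [ a ≤b] = iverson (does (a Fin.≤? b))

      upToB : List (Fin γ)
      upToB = filter (Fin._≤? b) (allFin γ)

      multiplicity-upToB : ∀ a → multiplicity a upToB K.≈ [ a ≤b]
      multiplicity-upToB a = ≈-iverson (a Fin.≤? b)
        (λ a≤b → multiplicity-∈ _ (filter⁺ (Fin._≤? b) (allFin⁺ γ))
                   (∈-filter⁺ (Fin._≤? b) (∈-allFin a) a≤b))
        (λ a≰b → multiplicity-∉ _ (a≰b ∘ proj₂ ∘ ∈-filter⁻ (Fin._≤? b) {xs = allFin γ}))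

      χ-• : ∀ x → χ x (• b) K.≈ [ index x ≤b]
      -- `π` is the identity on elements, so `• b` is `generatorSum upToB` by computation.
      χ-• x = K.trans (χ-generatorSum x upToB) (multiplicity-upToB (index x))

      associator-• : Element 3
      associator-• = associator (diasPresentation γ) (• b)

      -- This is the universal property of the maximum: a bound on `a ↑ a′` is a bound on both `a`
      -- and `a′`.
      [↑≤b] : ∀ a a′ → [ a ↑ a′ ≤b] K.≈ [ a ≤b] K.* [ a′ ≤b]
      [↑≤b] a a′ = K.trans
        (K.reflexive (cong iverson
          (does-⇔ ↑≤b⇔ ((a ↑ a′) Fin.≤? b) ((a Fin.≤? b) ×-dec (a′ Fin.≤? b)))))
        (iverson-∧ (does (a Fin.≤? b)) _)
        where
        ↑≤b⇔ : (a ↑ a′) Fin.≤ b ⇔ (a Fin.≤ b × a′ Fin.≤ b)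
        ↑≤b⇔ = mk⇔
          (λ ↑≤b → x⊔y≤z⇒x≤z a a′ ↑≤b , x⊔y≤z⇒y≤z a a′ ↑≤b)
          (λ (a≤b , a′≤b) → ⊔-lub a≤b a′≤b)

      -- The common form of `rel₂` to `rel₅`, up to symmetry and the order of the factors; `rel₁` is
      -- commutativity alone.
      [≤b]-absorbs-↑ : ∀ a a′ → [ a ≤b] K.* [ a ↑ a′ ≤b] K.≈ [ a ≤b] K.* [ a′ ≤b]
      [≤b]-absorbs-↑ a a′ = begin
        [ a ≤b] K.* [ a ↑ a′ ≤b]            ≈⟨ K.*-congˡ ([↑≤b] a a′) ⟩
        [ a ≤b] K.* ([ a ≤b] K.* [ a′ ≤b])  ≈⟨ K.*-assoc _ _ _ ⟨
        ([ a ≤b] K.* [ a ≤b]) K.* [ a′ ≤b]  ≈⟨ K.*-congʳ (iverson-idempotent (does (a Fin.≤? b))) ⟩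
        [ a ≤b] K.* [ a′ ≤b]                ∎

      associator-•-orthogonal : ∀ x y x′ y′ →
        [ index x ≤b] K.* [ index y ≤b] K.≈ [ index x′ ≤b] K.* [ index y′ ≤b] →
        pairing (diasPresentation γ)
          (generator x ∘₁ generator y +ᴹ -ᴹ (generator x′ ∘₂ generator y′)) associator-• K.≈ 0#
      associator-•-orthogonal x y x′ y′ eq =
        associator-orthogonal (diasPresentation γ) (• b) x y x′ y′ (begin
          χ x (• b) K.* χ y (• b)            ≈⟨ K.*-cong (χ-• x) (χ-• y) ⟩
          [ index x ≤b] K.* [ index y ≤b]    ≈⟨ eq ⟩
          [ index x′ ≤b] K.* [ index y′ ≤b]  ≈⟨ K.*-cong (χ-• x′) (χ-• y′) ⟨
          χ x′ (• b) K.* χ y′ (• b)          ∎)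

      associator-•-⊥-relation : ∀ {g} → DiasRelation γ g →
        pairing (diasPresentation γ) g associator-• K.≈ 0#
      associator-•-⊥-relation (rel₁ a a′) =
        associator-•-orthogonal (⊣ a) (⊢ a′) (⊢ a′) (⊣ a) (K.*-comm _ _)
      associator-•-⊥-relation (rel₂ a a′) =
        associator-•-orthogonal (⊣ a) (⊣ (a ↑ a′)) (⊣ a) (⊢ a′) ([≤b]-absorbs-↑ a a′)
      associator-•-⊥-relation (rel₃ a a′) =
        associator-•-orthogonal (⊢ a) (⊣ a′) (⊢ a) (⊢ (a ↑ a′)) (K.sym ([≤b]-absorbs-↑ a a′))
      associator-•-⊥-relation (rel₄ a a′) =
        associator-•-orthogonal (⊣ (a ↑ a′)) (⊣ a) (⊣ a) (⊣ a′)
          (K.trans (K.*-comm _ _) ([≤b]-absorbs-↑ a a′))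
      associator-•-⊥-relation (rel₅ a a′) =
        associator-•-orthogonal (⊢ a) (⊢ a′) (⊢ (a ↑ a′)) (⊢ a)
          (K.trans (K.sym ([≤b]-absorbs-↑ a a′)) (K.*-comm _ _))

      -- Vanishing of the pairing is a linear condition on its first argument and respects `≋`, so
      -- it passes from the five families to their span.
      associator-•∈Rels⊥ : Rels⊥ (diasPresentation γ) associator-•
      associator-•∈Rels⊥ (incl g)     = associator-•-⊥-relation g
      associator-•∈Rels⊥ (resp g≋h g) = K.trans
        (extend-cong (leftModule {R = K.ring}) _ (≋-sym g≋h)) (associator-•∈Rels⊥ g)
      associator-•∈Rels⊥ zero         = K.refl
      associator-•∈Rels⊥ (add g h)    = K.trans
        (K.+-cong (associator-•∈Rels⊥ g) (associator-•∈Rels⊥ h)) (K.+-identityˡ 0#)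
      associator-•∈Rels⊥ (scale k g)  = K.trans (K.*-congˡ (associator-•∈Rels⊥ g)) (K.zeroʳ k)

proposition4p1p3 : ∀ {c ℓ₁ ℓ₂} (K : HeytingField c ℓ₁ ℓ₂) → CharacteristicZero K →
    let open OverField K in
    (γ : ℕ) (b : Fin γ) → IsAssociative (Dendr γ) (• b)
-- Equality in the quotient is membership of the difference in the ideal, and here that difference
-- is definitionally the associator.
proposition4p1p3 K _ γ b = OverField.incl (associator-•∈Rels⊥ K b)
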